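{- For each pair of integers $(m,k)\in\{(3,2),(3,3),(4,2)\}$, there exist infinitely many pairs of positive integers $(N,d)$ such that each of $N, N+d, \ldots, N+(m-1)d$ is $k$-full and $\gcd(d,N)=1$.
   Context: For an integer $k\ge 2$, a positive integer $n$ is called $k$-full if every prime $p$ dividing $n$ satisfies $p^k\mid n$. -}

module Defs where

open import Data.Nat using (ℕ; _+_; _*_; _^_; _<_)
open import Data.Nat.Divisibility using (_∣_)
open import Data.Nat.Primality using (Prime)
open import Data.Nat.GCD using (gcd)
open import Data.Product using (_×_; ∃₂)
open import Relation.Binary.PropositionalEquality using (_≡_)

Full : ℕ → ℕ → Set
Full k n = 0 < n × (∀ p → Prime p → p ∣ n → p ^ k ∣ n)

APFull : ℕ → ℕ → ℕ → ℕ → Set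
APFull m k N d = ∀ i → i < m → Full k (N + i * d)

Good : ℕ → ℕ → ℕ → ℕ → Set
Good m k N d = 0 < N × 0 < d × APFull m k N d × gcd d N ≡ 1

InfinitelyManyGood : ℕ → ℕ → Set
InfinitelyManyGood m k = ∀ B → ∃₂ λ N d → B < N + d × Good m k N d

{-# OPTIONS --safe #-}
module Submission where

-- For k = 3, a point of x³ + y³ = 6z³ with x, y > 0 gives the progression x³, 3z³, y³, where 3 ∣ z
-- automatically. Doubling a point keeps x, y coprime but makes their signs opposite; further
-- doublings move it away from the flex (1 : −1 : 0) until the signs agree again.
-- For k = 2, in a progression N, N + d, N + 2d, N + 3d the ratio X = 6d/N is the abscissa of a point
-- on a quadratic twist of w² = (X + 2)(X + 3)(X + 6). Tripling that point multiplies each of the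
-- four terms by a square, hence preserves 2-fullness, and one coprime progression generates
-- infinitely many. Three of the four terms settle (3, 2).

open import Defs
open import Data.Empty using (⊥; ⊥-elim)
open import Data.Integer
  using (ℤ; +_; -[1+_]; +[1+_]; 0ℤ; 1ℤ; _+_; _-_; _*_; -_; _^_; _<_; _≤_; +<+; +≤+)
  renaming (∣_∣ to abs)
open import Data.Integer.Divisibility.Signed
open import Data.Integer.Properties
open import Data.Integer.Tactic.RingSolver using (solve-∀)
open import Data.List using ([]; _∷_)
open import Data.List.Relation.Unary.All using (_∷_)
open import Data.Nat using (ℕ; zero; suc; z≤n; s≤s)
import Data.Nat as ℕ
import Data.Nat.Divisibility as ℕ
import Data.Nat.Properties as ℕ
open import Data.Nat.Coprimality using (coprime⇒gcd≡1)
open import Data.Nat.Primality using (Prime; prime[2]; ¬prime[1]; prime?; euclidsLemma; prime⇒irreducible)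
open import Data.Nat.Primality.Factorisation using (factorise; PrimeFactorisation)
open import Data.Product using (_×_; _,_; proj₁; proj₂; ∃; ∃₂)
open import Data.Sum using (_⊎_; inj₁; inj₂; [_,_]′)
open import Function using (_∘_)
open import Relation.Binary.Definitions using (Tri; tri<; tri≈; tri>)
open import Relation.Binary.PropositionalEquality using (_≡_; _≢_; refl; sym; trans; cong; cong₂; subst)
open import Relation.Nullary using (¬_)
open import Relation.Nullary.Decidable using (from-yes; from-no)

private variable
  a b c s t u v w x y z : ℤ
  p B : ℕ

-- Order on ℤ

0<+ : 0ℤ < a → 0ℤ < b → 0ℤ < a + b
0<+ = +-mono-<

0<+0≤ : 0ℤ < a → 0ℤ ≤ b → 0ℤ < a + b
0<+0≤ = +-mono-<-≤

0≤+ : 0ℤ ≤ a → 0ℤ ≤ b → 0ℤ ≤ a + b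
0≤+ = +-mono-≤

0<* : 0ℤ < a → 0ℤ < b → 0ℤ < a * b
0<* {+[1+ _ ]} {+[1+ _ ]} _ _ = +<+ (s≤s z≤n)
0<* {+ 0}      (+<+ ())
0<* {+[1+ _ ]} {+ 0} _ (+<+ ())

0<suc : ∀ n → 0ℤ < + suc n
0<suc n = +<+ (s≤s z≤n)

0≤* : 0ℤ ≤ a → 0ℤ ≤ b → 0ℤ ≤ a * b
0≤* {+ m} {+ n} _ _ = subst (0ℤ ≤_) (pos-* m n) (+≤+ z≤n)

0<square : a ≢ 0ℤ → 0ℤ < a * a
0<square {+ 0}      a≢0 = ⊥-elim (a≢0 refl)
0<square {+[1+ _ ]} _   = +<+ (s≤s z≤n)
0<square { -[1+ _ ]} _  = +<+ (s≤s z≤n)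

<⇒0<- : a < b → 0ℤ < b - a
<⇒0<- {a} {b} a<b = subst (_< b - a) (+-inverseʳ a) (+-monoˡ-< (- a) a<b)

≤⇒0≤- : a ≤ b → 0ℤ ≤ b - a
≤⇒0≤- = i≤j⇒0≤j-i

cancel : ∀ a b → a + (b - a) ≡ b
cancel = solve-∀

-≡⇒< : b - a ≡ t → 0ℤ < t → a < b
-≡⇒< {b} {a} refl 0<t = subst (_< b) (+-identityʳ a) (subst (a + 0ℤ <_) (cancel a b) (+-monoʳ-< a 0<t))

-≡⇒≤ : b - a ≡ t → 0ℤ ≤ t → a ≤ b
-≡⇒≤ {b} {a} refl 0≤t = subst (_≤ b) (+-identityʳ a) (subst (a + 0ℤ ≤_) (cancel a b) (+-monoʳ-≤ a 0≤t))

0<⇒0≤-1 : 0ℤ < a → 0ℤ ≤ a - 1ℤ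
0<⇒0≤-1 {a} 0<a = ≤⇒0≤- (i<j⇒suc[i]≤j 0<a)

-- Reduces an equation that holds only modulo the relation `u ≡ v` to a polynomial identity with
-- cofactor `c`, which the ring solver can check.
≡-modulo : ∀ c → u ≡ v → t - s ≡ c * (u - v) → t ≡ s
≡-modulo {u} c refl e = i-j≡0⇒i≡j _ _ (trans e (trans (cong (c *_) (+-inverseʳ u)) (*-zeroʳ c)))

-- Divisibility by primes

∣-combination : ∀ x y → + p ∣ a → + p ∣ b → c ≡ x * a + y * b → + p ∣ c
∣-combination x y p∣a p∣b refl = ∣m∣n⇒∣m+n (∣n⇒∣m*n x p∣a) (∣n⇒∣m*n y p∣b)

∣-split : Prime p → ∀ a b → + p ∣ a * b → + p ∣ a ⊎ + p ∣ b
∣-split p-prime a b p∣ab with euclidsLemma (abs a) (abs b) p-prime (subst (_ ℕ.∣_) (abs-* a b) (∣⇒∣ᵤ p∣ab))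
... | inj₁ p∣a = inj₁ (∣ᵤ⇒∣ p∣a)
... | inj₂ p∣b = inj₂ (∣ᵤ⇒∣ p∣b)

∣-square : Prime p → ∀ a → + p ∣ a * a → + p ∣ a
∣-square p-prime a = [ (λ x → x) , (λ x → x) ]′ ∘ ∣-split p-prime a a

∣-cube : Prime p → ∀ a → + p ∣ a * a * a → + p ∣ a
∣-cube p-prime a = [ ∣-square p-prime a , (λ x → x) ]′ ∘ ∣-split p-prime (a * a) a

prime[3] : Prime 3
prime[3] = from-yes (prime? 3)

∣-prime⇒≡ : ∀ {q} → Prime p → Prime q → + p ∣ + q → p ≡ q
∣-prime⇒≡ p-prime q-prime p∣q with prime⇒irreducible q-prime (∣⇒∣ᵤ p∣q)
... | inj₁ refl = ⊥-elim (¬prime[1] p-prime)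
... | inj₂ p≡q  = p≡q

no-prime-divisor⇒≡1 : ∀ n → (∀ p → Prime p → p ℕ.∣ n → ⊥) → n ≡ 1
no-prime-divisor⇒≡1 0 none = ⊥-elim (none 2 prime[2] (2 ℕ.∣0))
no-prime-divisor⇒≡1 n@(suc _) none with factorise n
... | record { factors = [] ; isFactorisation = eq } = eq
... | record { factors = p ∷ ps ; isFactorisation = eq ; factorsPrime = p-prime ∷ _ } =
  ⊥-elim (none p p-prime (subst (p ℕ.∣_) (sym eq) (ℕ.m∣m*n _)))

-- Stated through primes because the arguments split products by Euclid's lemma.
Coprimeℤ : ℤ → ℤ → Set
Coprimeℤ a b = ∀ p → Prime p → + p ∣ a → + p ∣ b → ⊥

coprimeℤ-sym : Coprimeℤ a b → Coprimeℤ b a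
coprimeℤ-sym co p p-prime p∣b p∣a = co p p-prime p∣a p∣b

coprimeℤ-0⇒≡1 : Coprimeℤ a 0ℤ → abs a ≡ 1
coprimeℤ-0⇒≡1 {a} co = no-prime-divisor⇒≡1 (abs a) λ p p-prime p∣a → co p p-prime (∣ᵤ⇒∣ p∣a) (∣ᵤ⇒∣ (p ℕ.∣0))

-- k-full integers

-- Positivity is included because `abs` forgets the sign.
Fullℤ : ℕ → ℤ → Set
Fullℤ k z = 0ℤ < z × Full k (abs z)

0<⇒0<∣∣ : 0ℤ < a → 0 ℕ.< abs a
0<⇒0<∣∣ {+[1+ _ ]} _ = s≤s z≤n
0<⇒0<∣∣ {+ 0} (+<+ ())

^-pres-∣ : ∀ {m n} k → m ℕ.∣ n → m ℕ.^ k ℕ.∣ n ℕ.^ k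
^-pres-∣ zero    _   = ℕ.∣-refl
^-pres-∣ (suc k) m∣n = ℕ.*-pres-∣ m∣n (^-pres-∣ k m∣n)

prime-∣-^ : ∀ n k → Prime p → p ℕ.∣ n ℕ.^ k → p ℕ.∣ n
prime-∣-^ n zero    p-prime p∣1 = ⊥-elim (¬prime[1] (subst Prime (ℕ.∣1⇒≡1 p∣1) p-prime))
prime-∣-^ n (suc k) p-prime p∣n^ = [ (λ x → x) , prime-∣-^ n k p-prime ]′ (euclidsLemma n (n ℕ.^ k) p-prime p∣n^)

abs-^ : ∀ a k → abs (a ^ k) ≡ abs a ℕ.^ k
abs-^ a zero    = refl
abs-^ a (suc k) = trans (abs-* a (a ^ k)) (cong (abs a ℕ.*_) (abs-^ a k))

-- A prime dividing the coefficient `c` either has its `k`-th power there or divides `g`, in which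
-- case `g ^ k` supplies the power.
fullℤ-*^ : ∀ k c g → 0ℤ < c * g ^ k → (∀ p → Prime p → p ℕ.∣ abs c → p ℕ.^ k ℕ.∣ abs c ⊎ p ℕ.∣ abs g) →
           Fullℤ k (c * g ^ k)
fullℤ-*^ k c g 0<cgᵏ split = 0<cgᵏ , 0<⇒0<∣∣ 0<cgᵏ , full
  where
  abs-eq : abs (c * g ^ k) ≡ abs c ℕ.* abs g ℕ.^ k
  abs-eq = trans (abs-* c (g ^ k)) (cong (abs c ℕ.*_) (abs-^ g k))

  from-g : ∀ p → p ℕ.∣ abs g → p ℕ.^ k ℕ.∣ abs c ℕ.* abs g ℕ.^ k
  from-g p p∣g = ℕ.∣n⇒∣m*n (abs c) (^-pres-∣ k p∣g)

  full′ : ∀ p → Prime p → p ℕ.∣ abs c ℕ.* abs g ℕ.^ k → p ℕ.^ k ℕ.∣ abs c ℕ.* abs g ℕ.^ k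
  full′ p p-prime p∣cgᵏ with euclidsLemma (abs c) (abs g ℕ.^ k) p-prime p∣cgᵏ
  ... | inj₁ p∣c  = [ ℕ.∣m⇒∣m*n (abs g ℕ.^ k) , from-g p ]′ (split p p-prime p∣c)
  ... | inj₂ p∣gᵏ = from-g p (prime-∣-^ (abs g) k p-prime p∣gᵏ)

  full : ∀ p → Prime p → p ℕ.∣ abs (c * g ^ k) → p ℕ.^ k ℕ.∣ abs (c * g ^ k)
  full p p-prime p∣ = subst (p ℕ.^ k ℕ.∣_) (sym abs-eq) (full′ p p-prime (subst (p ℕ.∣_) abs-eq p∣))

fullℤ-*-square : ∀ {c} g → g ≢ 0ℤ → Fullℤ 2 c → Fullℤ 2 (c * g ^ 2)
fullℤ-*-square {c} g g≢0 (0<c , _ , full) = fullℤ-*^ 2 c g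
  (0<* 0<c (subst (λ h → 0ℤ < g * h) (sym (*-identityʳ g)) (0<square g≢0)))
  (λ p p-prime p∣c → inj₁ (full p p-prime p∣c))

goodℤ : ∀ m k B a d → + B < a + d → 0ℤ < a → 0ℤ < d → (∀ i → i ℕ.< m → Fullℤ k (a + + i * d)) →
        Coprimeℤ d a → ∃₂ λ N D → B ℕ.< N ℕ.+ D × Good m k N D
goodℤ m k B (+ N) (+ D) (+<+ B<N+D) (+<+ 0<N) (+<+ 0<D) full co =
  N , D , B<N+D , 0<N , 0<D , (λ i i<m → subst (Full k) (term i) (proj₂ (full i i<m))) ,
  coprime⇒gcd≡1 λ {g} (g∣D , g∣N) → no-prime-divisor⇒≡1 g λ p p-prime p∣g →
    co p p-prime (∣ᵤ⇒∣ (ℕ.∣-trans p∣g g∣D)) (∣ᵤ⇒∣ (ℕ.∣-trans p∣g g∣N))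
  where
  term : ∀ i → abs (+ N + + i * + D) ≡ N ℕ.+ i ℕ.* D
  term i = cong (λ z → abs (+ N + z)) (sym (pos-* i D))

-- 3-full progressions on the cubic x³ + y³ = 6z³

record Sol (x y z : ℤ) : Set where
  field
    equation : x * x * x + y * y * y ≡ + 6 * (z * z * z)
    x⊥y      : Coprimeℤ x y

open Sol

sol-cong : ∀ {x′ y′ z′} → x ≡ x′ → y ≡ y′ → z ≡ z′ → Sol x y z → Sol x′ y′ z′
sol-cong refl refl refl σ = σ

sol-swap : Sol x y z → Sol y x z
sol-swap {x} {y} σ = record
  { equation = trans (+-comm (y * y * y) (x * x * x)) (equation σ)
  ; x⊥y      = coprimeℤ-sym (x⊥y σ) }

-- `(x + y)³` differs from `x³ + y³ = 6z³` by `3xy(x + y)`, so 3 divides it.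
sol⇒3∣x+y : Sol x y z → + 3 ∣ x + y
sol⇒3∣x+y {x} {y} {z} σ = ∣-cube prime[3] (x + y)
  (divides (+ 2 * (z * z * z) + x * y * (x + y)) (≡-modulo 1ℤ (equation σ) (identity x y z)))
  where
  identity : ∀ x y z → (x + y) * (x + y) * (x + y) - (+ 2 * (z * z * z) + x * y * (x + y)) * + 3
                       ≡ 1ℤ * (x * x * x + y * y * y - + 6 * (z * z * z))
  identity = solve-∀

-- With 3 ∣ x + y, the left side x³ + y³ is divisible by 9, whereas 6 is not.
sol⇒3∣z : Sol x y z → + 3 ∣ z
sol⇒3∣z {x} {y} {z} σ with sol⇒3∣x+y σ
... | divides t x+y≡3t = ∣-cube prime[3] z (∣-combination (z * z * z) (- 1ℤ) ∣-refl 3∣2z³ (identity₃ (z * z * z)))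
  where
  identity₁ : ∀ x y z → + 3 * (+ 2 * (z * z * z)) - (x + y) * ((x + y) * (x + y) - + 3 * (x * y))
                        ≡ - 1ℤ * (x * x * x + y * y * y - + 6 * (z * z * z))
  identity₁ = solve-∀
  identity₂ : ∀ t q → t * + 3 * (t * + 3 * (t * + 3) - + 3 * q) ≡ t * (+ 3 * t * t - q) * (+ 3 * + 3)
  identity₂ = solve-∀
  identity₃ : ∀ c → c ≡ c * + 3 + - 1ℤ * (+ 2 * c)
  identity₃ = solve-∀
  3∣2z³ : + 3 ∣ + 2 * (z * z * z)
  3∣2z³ = *-cancelˡ-∣ (+ 3) (divides (t * (+ 3 * t * t - x * y)) (trans
    (subst (λ s → + 3 * (+ 2 * (z * z * z)) ≡ s * (s * s - + 3 * (x * y))) x+y≡3t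
      (≡-modulo (- 1ℤ) (equation σ) (identity₁ x y z)))
    (identity₂ t (x * y))))

-- The tangent at (x : y : z) meets the cubic again in this point.
sol-double : Sol x y z →
  Sol (- (x * (x * x * x + + 2 * (y * y * y)))) (y * (+ 2 * (x * x * x) + y * y * y)) (z * (y * y * y - x * x * x))
sol-double {x} {y} {z} σ = record
  { equation = ≡-modulo ((y * y * y - x * x * x) * (y * y * y - x * x * x) * (y * y * y - x * x * x)) (equation σ) (identity x y z)
  -- A common prime divides `x` or `x³ + 2y³`, and `y` or `2x³ + y³`; every combination makes it a
  -- common prime of `x` and `y`.
  ; x⊥y      = λ p p-prime p∣X p∣Y →
      [ (λ p∣x → x⊥y σ p p-prime p∣x (x∣⇒y∣ p-prime p∣x p∣Y))
      , (λ p∣f → [ (λ p∣y → x⊥y σ p p-prime (y∣⇒x∣ p-prime p∣y p∣f) p∣y)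
                 , both p-prime p∣f ]′ (∣-split p-prime y _ p∣Y)) ]′
      (∣-split p-prime x _ (subst (+ p ∣_) (neg-involutive _) (∣m⇒∣-m p∣X))) }
  where
  identity : ∀ x y z →
    let X = - (x * (x * x * x + + 2 * (y * y * y)))
        Y = y * (+ 2 * (x * x * x) + y * y * y)
        d = y * y * y - x * x * x in
    X * X * X + Y * Y * Y - + 6 * (z * d * (z * d) * (z * d)) ≡ d * d * d * (x * x * x + y * y * y - + 6 * (z * z * z))
  identity = solve-∀

  id₁ : ∀ x y → y * (y * y * y) ≡ - (+ 2 * x * x * y) * x + 1ℤ * (y * (+ 2 * (x * x * x) + y * y * y))
  id₁ = solve-∀
  id₂ : ∀ x y → x * x * x ≡ - (+ 2 * y * y) * y + 1ℤ * (x * x * x + + 2 * (y * y * y))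
  id₂ = solve-∀
  id₃ : ∀ x y → + 3 * (x * x * x) ≡ - 1ℤ * (x * x * x + + 2 * (y * y * y)) + + 2 * (+ 2 * (x * x * x) + y * y * y)
  id₃ = solve-∀
  id₄ : ∀ x y → x * x * x ≡ - 1ℤ * (x * x * x + + 2 * (y * y * y)) + + 2 * (x * x - x * y + y * y) * (x + y)
  id₄ = solve-∀
  id₅ : ∀ x y → y * y * y ≡ 1ℤ * (+ 2 * (x * x * x) + y * y * y) + - (+ 2 * x * x) * x
  id₅ = solve-∀

  x∣⇒y∣ : Prime p → + p ∣ x → + p ∣ y * (+ 2 * (x * x * x) + y * y * y) → + p ∣ y
  x∣⇒y∣ p-prime p∣x p∣Y =
    [ (λ p∣y → p∣y) , ∣-cube p-prime y ]′ (∣-split p-prime y _ (∣-combination (- (+ 2 * x * x * y)) 1ℤ p∣x p∣Y (id₁ x y)))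

  y∣⇒x∣ : Prime p → + p ∣ y → + p ∣ x * x * x + + 2 * (y * y * y) → + p ∣ x
  y∣⇒x∣ p-prime p∣y p∣f = ∣-cube p-prime x (∣-combination (- (+ 2 * y * y)) 1ℤ p∣y p∣f (id₂ x y))

  both : Prime p → + p ∣ x * x * x + + 2 * (y * y * y) → + p ∣ + 2 * (x * x * x) + y * y * y → ⊥
  both {p} p-prime p∣f p∣g = x⊥y σ p p-prime p∣x (∣-cube p-prime y (∣-combination 1ℤ (- (+ 2 * x * x)) p∣g p∣x (id₅ x y)))
    where
    p∣x : + p ∣ x
    -- `3x³` is a combination of the two cofactors, so `p` divides 3 or `x³`. In the first case it
    -- divides `x + y`, and `x³ = 2(x³ + y³) − (x³ + 2y³)`.
    p∣x = [ (λ p∣3 → ∣-cube p-prime x (∣-combination (- 1ℤ) (+ 2 * (x * x - x * y + y * y)) p∣f (∣-trans p∣3 (sol⇒3∣x+y σ)) (id₄ x y)))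
          , ∣-cube p-prime x ]′ (∣-split p-prime (+ 3) _ (∣-combination (- 1ℤ) (+ 2) p∣f p∣g (id₃ x y)))

-- Signs and size under repeated doubling

record Inner (B : ℕ) (x y z : ℤ) : Set where
  constructor inner
  field
    sol : Sol x y z
    0<x : 0ℤ < x
    x<y : x < y
    0<z : 0ℤ < z
    B<y : + B < y

∃Inner : ℕ → Set
∃Inner B = ∃ λ x → ∃₂ λ y z → Inner B x y z

-- The negative coordinate is stored as `- w`, so that all bounds concern positive numbers. As in
-- `Inner`, `B` is a lower bound for the larger coordinate; raising it yields infinitely many
-- solutions.
record Outer (B : ℕ) (w y z : ℤ) : Set where
  constructor outer
  field
    sol : Sol (- w) y z
    0<w : 0ℤ < w
    w<y : w < y
    0<z : 0ℤ < z
    B<y : + B < y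

0<cube : 0ℤ < a → 0ℤ < a * a * a
0<cube 0<a = 0<* (0<* 0<a 0<a) 0<a

cube-< : 0ℤ < a → a < b → a * a * a < b * b * b
cube-< {a} {b} 0<a a<b = -≡⇒< (identity a b)
  (0<* (<⇒0<- a<b) (0<+ (0<+ (0<* 0<a 0<a) (0<* 0<a 0<b)) (0<* 0<b 0<b)))
  where
  0<b = <-trans 0<a a<b
  identity : ∀ a b → b * b * b - a * a * a ≡ (b - a) * (a * a + a * b + b * b)
  identity = solve-∀

-- Doubling makes the signs opposite and strictly enlarges `y`, which raises the bound by one.
inner⇒outer : Inner B x y z → ∃ λ w → ∃₂ λ y z → Outer (suc B) w y z
inner⇒outer {x = x} {y} {z} (inner σ 0<x x<y 0<z B<y) = _ , _ , _ , outer (sol-double σ)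
  (0<* 0<x (0<+ (0<cube 0<x) (0<* (0<suc 1) (0<cube 0<y))))
  (-≡⇒< (id₁ x y) (0<* (0<+ 0<x 0<y) (0<cube (<⇒0<- x<y))))
  (0<* 0<z (<⇒0<- (cube-< 0<x x<y)))
  (≤-<-trans (i<j⇒suc[i]≤j B<y)
    (-≡⇒< (id₂ x y) (0<* 0<y (0<+0≤ (0<* (0<suc 1) (0<cube 0<x)) (0<⇒0≤-1 (0<cube 0<y))))))
  where
  0<y = <-trans 0<x x<y
  id₁ : ∀ x y → y * (+ 2 * (x * x * x) + y * y * y) - x * (x * x * x + + 2 * (y * y * y)) ≡ (x + y) * ((y - x) * (y - x) * (y - x))
  id₁ = solve-∀
  id₂ : ∀ x y → y * (+ 2 * (x * x * x) + y * y * y) - y ≡ y * (+ 2 * (x * x * x) + (y * y * y - 1ℤ))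
  id₂ = solve-∀

module _ (o : Outer B w y z) where
  open Outer o

  private
    0<y : 0ℤ < y
    0<y = <-trans 0<w w<y

  -- The first coordinate is positive since `w < y`; the sign of the second is that of `y³ − 2w³`,
  -- which decides between `Inner` and `Outer`.
  outer-double : Sol (w * (+ 2 * (y * y * y) - w * w * w)) (y * (y * y * y - + 2 * (w * w * w))) (z * (y * y * y + w * w * w))
  outer-double = sol-cong (id₁ w y) (id₂ w y) (id₃ w y z) (sol-double sol)
    where
    id₁ : ∀ w y → - (- w * (- w * - w * - w + + 2 * (y * y * y))) ≡ w * (+ 2 * (y * y * y) - w * w * w)
    id₁ = solve-∀
    id₂ : ∀ w y → y * (+ 2 * (- w * - w * - w) + y * y * y) ≡ y * (y * y * y - + 2 * (w * w * w))
    id₂ = solve-∀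
    id₃ : ∀ w y z → z * (y * y * y - - w * - w * - w) ≡ z * (y * y * y + w * w * w)
    id₃ = solve-∀

  -- Keeps the bound `B` through a doubling: in either outcome the larger new coordinate is at least
  -- this one.
  y<x′ : y < w * (+ 2 * (y * y * y) - w * w * w)
  y<x′ = -≡⇒< (identity w y)
    (0<+0≤ (0<* 0<w (<⇒0<- (cube-< 0<w w<y)))
           (0≤* (<⇒≤ 0<y) (0<⇒0≤-1 (0<* (0<* 0<y 0<y) 0<w))))
    where
    identity : ∀ w y → w * (+ 2 * (y * y * y) - w * w * w) - y ≡ w * (y * y * y - w * w * w) + y * (y * y * w - 1ℤ)
    identity = solve-∀

  0<z′ : 0ℤ < z * (y * y * y + w * w * w)
  0<z′ = 0<* 0<z (0<+ (0<cube 0<y) (0<cube 0<w))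

  outer⇒inner : + 2 * (w * w * w) < y * y * y → ∃Inner B
  outer⇒inner 2w³<y³ with <-cmp (w * (+ 2 * (y * y * y) - w * w * w)) (y * (y * y * y - + 2 * (w * w * w)))
  ... | tri< x′<y′ _ _ = _ , _ , _ , inner outer-double (<-trans 0<y y<x′) x′<y′ 0<z′ (<-trans (<-trans B<y y<x′) x′<y′)
  ... | tri> _ _ y′<x′ = _ , _ , _ , inner (sol-swap outer-double) (0<* 0<y (<⇒0<- 2w³<y³)) y′<x′ 0<z′ (<-trans B<y y<x′)
  -- If the coordinates agree, 3 divides their sum `2x′`, hence both of them, against coprimality.
  ... | tri≈ _ x′≡y′ _ = ⊥-elim (x⊥y outer-double 3 prime[3] 3∣x′ (subst (+ 3 ∣_) x′≡y′ 3∣x′))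
    where
    identity : ∀ x → x ≡ x * + 3 + - 1ℤ * (x + x)
    identity = solve-∀
    x′ : ℤ
    x′ = w * (+ 2 * (y * y * y) - w * w * w)
    3∣x′ : + 3 ∣ x′
    3∣x′ = ∣-combination x′ (- 1ℤ) ∣-refl (subst (λ y′ → + 3 ∣ x′ + y′) (sym x′≡y′) (sol⇒3∣x+y outer-double)) (identity x′)

  -- Equality would make `y` even and turn the equation into `w³ = 6z³`, so `w` would be even too.
  2w³≢y³ : + 2 * (w * w * w) ≢ y * y * y
  2w³≢y³ eq = x⊥y sol 2 prime[2] (∣m⇒∣-m 2∣w) 2∣y
    where
    2∣y : + 2 ∣ y
    2∣y = ∣-cube prime[2] y (divides (w * w * w) (trans (sym eq) (*-comm (+ 2) (w * w * w))))
    identity : ∀ w y z → w * w * w - + 3 * (z * z * z) * + 2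
                         ≡ 1ℤ * (- w * - w * - w + y * y * y + + 2 * (w * w * w) - (+ 6 * (z * z * z) + y * y * y))
    identity = solve-∀
    2∣w : + 2 ∣ w
    2∣w = ∣-cube prime[2] w (divides (+ 3 * (z * z * z)) (≡-modulo 1ℤ (cong₂ _+_ (equation sol) eq) (identity w y z)))

  outer-next : y * y * y < + 2 * (w * w * w) →
    Outer B (y * (+ 2 * (w * w * w) - y * y * y)) (w * (+ 2 * (y * y * y) - w * w * w)) (z * (y * y * y + w * w * w))
  outer-next y³<2w³ = outer (sol-cong (identity₁ w y) refl refl (sol-swap outer-double))
    (0<* 0<y (<⇒0<- y³<2w³))
    (-≡⇒< (identity₂ w y) (0<* (<⇒0<- w<y) (0<cube (0<+ 0<y 0<w))))
    0<z′ (<-trans B<y y<x′)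
    where
    identity₁ : ∀ w y → y * (y * y * y - + 2 * (w * w * w)) ≡ - (y * (+ 2 * (w * w * w) - y * y * y))
    identity₁ = solve-∀
    identity₂ : ∀ w y → w * (+ 2 * (y * y * y) - w * w * w) - y * (+ 2 * (w * w * w) - y * y * y)
                        ≡ (y - w) * ((y + w) * (y + w) * (y + w))
    identity₂ = solve-∀

  -- Expanded in `h = y − 2w ≥ 0`, the difference `y³ − 2w³` has positive coefficients.
  w≤y-w⇒2w³<y³ : w ≤ y - w → + 2 * (w * w * w) < y * y * y
  w≤y-w⇒2w³<y³ w≤y-w = -≡⇒< (identity w y)
    (0<+0≤ (0<* (0<suc 5) (0<cube 0<w))
      (0≤* 0≤h (0≤+ (0≤+ (0≤* (0≤* (<⇒≤ (0<suc 11)) 0≤w) 0≤w) (0≤* (0≤* (<⇒≤ (0<suc 5)) 0≤w) 0≤h)) (0≤* 0≤h 0≤h))))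
    where
    0≤w = <⇒≤ 0<w
    0≤h = ≤⇒0≤- w≤y-w
    identity : ∀ w y → let h = y - w - w in
      y * y * y - + 2 * (w * w * w) ≡ + 6 * (w * w * w) + h * (+ 12 * w * w + + 6 * w * h + h * h)
    identity = solve-∀

  -- One doubling at least halves the ratio w / (y − w).
  ratio-decreases : ∀ ν → 0ℤ ≤ ν → y * y * y < + 2 * (w * w * w) → w ≤ (1ℤ + (1ℤ + ν)) * (y - w) →
    let w′ = y * (+ 2 * (w * w * w) - y * y * y)
        y′ = w * (+ 2 * (y * y * y) - w * w * w) in
    -- Here `y′ − w′ = (y − w)(y + w)³`, while `2w′ ≤ w(y + w)³`; the last two summands of
    -- `identity` are the slack in this inequality. Half of `ν + 2` is at most `ν + 1`.
    w′ ≤ (1ℤ + ν) * (y′ - w′)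
  ratio-decreases ν 0≤ν y³<2w³ w≤ = -≡⇒≤ refl (*-cancelˡ-≤-pos 0ℤ _ (+ 2)
    (subst (0ℤ ≤_) (sym (identity ν w y))
      (0≤+ (0≤+ (0≤+ (0≤* (≤⇒0≤- w≤) 0≤s³) (0≤* (0≤* 0≤ν (<⇒≤ (<⇒0<- w<y))) 0≤s³))
        (<⇒≤ (0<* 0<w (0<+ (0<+ (0<+ (0<cube 0<y) (0<* (0<* (0<* (0<suc 2) 0<y) 0<y) 0<w)) (0<* (0<* 0<y 0<w) 0<w)) (0<cube 0<w)))))
        (<⇒≤ (0<* (0<* (0<suc 1) 0<y) (<⇒0<- (cube-< 0<w w<y)))))))
    where
    0≤s³ : 0ℤ ≤ (y + w) * (y + w) * (y + w)
    0≤s³ = <⇒≤ (0<cube (0<+ 0<y 0<w))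
    identity : ∀ ν w y →
      let w′ = y * (+ 2 * (w * w * w) - y * y * y)
          y′ = w * (+ 2 * (y * y * y) - w * w * w)
          s³ = (y + w) * (y + w) * (y + w) in
      + 2 * ((1ℤ + ν) * (y′ - w′) - w′) ≡
        ((1ℤ + (1ℤ + ν)) * (y - w) - w) * s³ + ν * (y - w) * s³
        + w * (y * y * y + + 3 * y * y * w + y * w * w + w * w * w)
        + + 2 * y * (y * y * y - w * w * w)
    identity = solve-∀

-- `suc n` bounds the ratio `w / (y − w)`. Each doubling that stays outer lowers the bound by one,
-- and at bound 1 the point must satisfy `2w³ < y³`, so the next doubling is inner.
descend : ∀ n → Outer B w y z → w ≤ + suc n * (y - w) → ∃Inner B
descend {w = w} {y = y} n o w≤ with <-cmp (+ 2 * (w * w * w)) (y * y * y)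
... | tri< 2w³<y³ _ _ = outer⇒inner o 2w³<y³
... | tri≈ _ 2w³≡y³ _ = ⊥-elim (2w³≢y³ o 2w³≡y³)
descend {w = w} {y = y} zero o w≤ | tri> _ _ y³<2w³ =
  ⊥-elim (<-asym y³<2w³ (w≤y-w⇒2w³<y³ o (subst (w ≤_) (*-identityˡ (y - w)) w≤)))
descend (suc n) o w≤ | tri> _ _ y³<2w³ = descend n (outer-next o y³<2w³) (ratio-decreases o (+ n) (+≤+ z≤n) y³<2w³ w≤)

inner-exists : ∀ B → ∃Inner B
-- The solution `17³ + 37³ = 6·21³`, coprime by `24·17 − 11·37 = 1`.
inner-exists zero = + 17 , + 37 , + 21 , inner
  record { equation = refl ; x⊥y = λ p p-prime p∣17 p∣37 →
    ¬prime[1] (subst Prime (ℕ.∣1⇒≡1 (∣⇒∣ᵤ (∣-combination {b = + 37} (+ 24) (- + 11) p∣17 p∣37 refl))) p-prime) }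
  (+<+ (s≤s z≤n)) (+<+ (ℕ.m≤m+n 18 19)) (+<+ (s≤s z≤n)) (+<+ (s≤s z≤n))
inner-exists (suc B) with inner⇒outer (proj₂ (proj₂ (proj₂ (inner-exists B))))
... | w , y , z , o = descend (abs w) o (bound (Outer.0<w o) (Outer.w<y o))
  where
  -- Since `y − w ≥ 1`, the ratio `w / (y − w)` is at most `w`, which serves as the initial bound.
  bound : ∀ {w y} → 0ℤ < w → w < y → w ≤ + suc (abs w) * (y - w)
  bound {w@(+[1+ n ])} {y} 0<w w<y = -≡⇒≤ (identity w (y - w))
    (0≤+ (0≤* (<⇒≤ 0<w) (0<⇒0≤-1 (<⇒0<- w<y))) (<⇒≤ (<⇒0<- w<y)))
    where
    identity : ∀ w e → (1ℤ + w) * e - w ≡ w * (e - 1ℤ) + e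
    identity = solve-∀
  bound {+ 0} (+<+ ())

-- The progressions of 3-full numbers

infinitely-many-3-3 : InfinitelyManyGood 3 3
-- The middle term is `3z³`, and `6z³ = x³ + y³` exceeds `y`, so `y > 2B` gives the required size.
infinitely-many-3-3 B with inner-exists (B ℕ.+ B)
... | x , y , z , inner σ 0<x x<y 0<z B<y = goodℤ 3 3 B (x * x * x) δ large (0<cube 0<x) 0<δ full co
  where
  0<y = <-trans 0<x x<y
  δ : ℤ
  δ = + 3 * (z * z * z) - x * x * x

  id₁ : ∀ x y z b → + 2 * (x * x * x + (+ 3 * (z * z * z) - x * x * x) - b) - (x * x * x + y * (y * y - 1ℤ) + (y - (b + b)))
                    ≡ - 1ℤ * (x * x * x + y * y * y - + 6 * (z * z * z))
  id₁ = solve-∀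
  id₂ : ∀ x y z → + 2 * (+ 3 * (z * z * z) - x * x * x) - (y * y * y - x * x * x)
                  ≡ - 1ℤ * (x * x * x + y * y * y - + 6 * (z * z * z))
  id₂ = solve-∀
  id₃ : ∀ x y z → y * y * y - (+ 2 * (+ 3 * (z * z * z) - x * x * x) + 1ℤ * (x * x * x))
                  ≡ 1ℤ * (x * x * x + y * y * y - + 6 * (z * z * z))
  id₃ = solve-∀

  large : + B < x * x * x + δ
  large = -≡⇒< refl (*-cancelˡ-<-nonNeg (+ 2) (subst (0ℤ <_) (sym (≡-modulo (- 1ℤ) (equation σ) (id₁ x y z (+ B))))
    (0<+ (0<+0≤ (0<cube 0<x) (0≤* (<⇒≤ 0<y) (0<⇒0≤-1 (0<* 0<y 0<y)))) (<⇒0<- B<y))))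

  0<δ : 0ℤ < δ
  0<δ = *-cancelˡ-<-nonNeg (+ 2) (subst (0ℤ <_) (sym (≡-modulo (- 1ℤ) (equation σ) (id₂ x y z))) (<⇒0<- (cube-< 0<x x<y)))

  co : Coprimeℤ δ (x * x * x)
  co p p-prime p∣δ p∣x³ = x⊥y σ p p-prime (∣-cube p-prime x p∣x³)
    (∣-cube p-prime y (∣-combination (+ 2) 1ℤ p∣δ p∣x³ (≡-modulo 1ℤ (equation σ) (id₃ x y z))))

  -- The cube is spelled out as `1ℤ * g ^ 3` unfolds, so that the ring solver meets only products.
  full-cube : ∀ g → 0ℤ < g → Fullℤ 3 (1ℤ * (g * (g * (g * 1ℤ))))
  full-cube g 0<g = fullℤ-*^ 3 1ℤ g (0<* (0<suc 0) (0<* 0<g (0<* 0<g (0<* 0<g (0<suc 0)))))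
    λ p p-prime p∣1 → ⊥-elim (¬prime[1] (subst Prime (ℕ.∣1⇒≡1 p∣1) p-prime))

  full : ∀ i → i ℕ.< 3 → Fullℤ 3 (x * x * x + + i * δ)
  full 0 _ = subst (Fullℤ 3) (identity x δ) (full-cube x 0<x)
    where
    identity : ∀ x δ → 1ℤ * (x * (x * (x * 1ℤ))) ≡ x * x * x + + 0 * δ
    identity = solve-∀
  full 1 _ = subst (Fullℤ 3) (identity x z) (fullℤ-*^ 3 (+ 3) z
      (0<* (0<suc 2) (0<* 0<z (0<* 0<z (0<* 0<z (0<suc 0)))))
      λ p p-prime p∣3 → inj₂ (ℕ.∣-trans p∣3 (∣⇒∣ᵤ (sol⇒3∣z σ))))
    where
    identity : ∀ x z → + 3 * (z * (z * (z * 1ℤ))) ≡ x * x * x + + 1 * (+ 3 * (z * z * z) - x * x * x)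
    identity = solve-∀
  full 2 _ = subst (Fullℤ 3) (≡-modulo 1ℤ (equation σ) (identity x y z)) (full-cube y 0<y)
    where
    identity : ∀ x y z → 1ℤ * (y * (y * (y * 1ℤ))) - (x * x * x + + 2 * (+ 3 * (z * z * z) - x * x * x))
                         ≡ 1ℤ * (x * x * x + y * y * y - + 6 * (z * z * z))
    identity = solve-∀
  full (suc (suc (suc _))) (s≤s (s≤s (s≤s ())))

-- Progressions M − 3e, M − e, M + e, M + 3e of 2-full integers

-- Centring at the midpoint `M` turns reversal into `e ↦ −e`; `e` may have either sign. The
-- conditions at 2 and 3 let coprimality survive tripling.
record Progression (M e : ℤ) : Set where
  constructor progression
  field
    coprime : Coprimeℤ M e
    odd     : ¬ + 2 ∣ M + e
    3∤M     : ¬ + 3 ∣ M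
    full₀   : Fullℤ 2 (M - + 3 * e)
    full₁   : Fullℤ 2 (M - e)
    full₂   : Fullℤ 2 (M + e)
    full₃   : Fullℤ 2 (M + + 3 * e)

-- Restores a positive difference when tripling yields a negative one.
flip : ∀ {M e} → Progression M e → Progression M (- e)
flip {M} {e} (progression co odd 3∤M f₀ f₁ f₂ f₃) = progression
  (λ p p-prime p∣M p∣-e → co p p-prime p∣M (subst (+ p ∣_) (neg-involutive e) (∣m⇒∣-m p∣-e)))
  (λ 2∣M-e → odd (∣-combination 1ℤ e 2∣M-e ∣-refl (id₁ M e)))
  3∤M
  (subst (Fullℤ 2) (id₂ M e) f₃) (subst (Fullℤ 2) (id₃ M e) f₂) f₁ (subst (Fullℤ 2) (id₄ M e) f₀)
  where
  id₁ : ∀ M e → M + e ≡ 1ℤ * (M + - e) + e * + 2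
  id₁ = solve-∀
  id₂ : ∀ M e → M + + 3 * e ≡ M - + 3 * - e
  id₂ = solve-∀
  id₃ : ∀ M e → M + e ≡ M - - e
  id₃ = solve-∀
  id₄ : ∀ M e → M - + 3 * e ≡ M + + 3 * - e
  id₄ = solve-∀

-- The tripling formulas

module Tripling (M e : ℤ) where
  opaque
    -- The outer terms get multiplied by `(A ± 2P)²`, the inner ones by `(A ± 2Q)²`. Opacity lets
    -- the ring solver treat these polynomials as variables.
    A P Q : ℤ
    A = M * M * M * M - + 9 * (e * e * e * e)
    P = + 3 * (M * (e * (M * M - e * e)))
    Q = M * (e * (M * M - + 9 * (e * e)))

  opaque
    -- `M′` is the midpoint of the new outer pair, `e′` half the difference of the new inner pair.
    M′ e′ : ℤ
    M′ = M * (A * A + + 4 * (P * P)) - + 12 * (e * (A * P))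
    e′ = e * (A * A + + 4 * (Q * Q)) - + 4 * (M * (A * Q))

  private
    opaque
      unfolding A P Q

      -- Says that the new outer and inner pairs have the same midpoint.
      PQ-relation₁ : M * (P * P) - + 3 * (e * (A * P)) ≡ M * (Q * Q) - e * (A * Q)
      PQ-relation₁ = identity M e
        where
        identity : ∀ M e →
          let A = M * M * M * M - + 9 * (e * e * e * e)
              P = + 3 * (M * (e * (M * M - e * e)))
              Q = M * (e * (M * M - + 9 * (e * e))) in
          M * (P * P) - + 3 * (e * (A * P)) ≡ M * (Q * Q) - e * (A * Q)
        identity = solve-∀

    opaque
      unfolding A P Q

      -- Says that the new outer pair is three times as far apart as the inner one.
      PQ-relation₂ : + 3 * (e * (P * P)) - M * (A * P) ≡ + 3 * (e * (Q * Q)) - + 3 * (M * (A * Q))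
      PQ-relation₂ = identity M e
        where
        identity : ∀ M e →
          let A = M * M * M * M - + 9 * (e * e * e * e)
              P = + 3 * (M * (e * (M * M - e * e)))
              Q = M * (e * (M * M - + 9 * (e * e))) in
          + 3 * (e * (P * P)) - M * (A * P) ≡ + 3 * (e * (Q * Q)) - + 3 * (M * (A * Q))
        identity = solve-∀

  opaque
    unfolding M′ e′

    term₀ : (M - + 3 * e) * (A + + 2 * P) ^ 2 ≡ M′ - + 3 * e′
    term₀ = ≡-modulo (- + 4) PQ-relation₂ (identity M e A P Q)
      where
      identity : ∀ M e A P Q →
        (M - + 3 * e) * ((A + + 2 * P) * ((A + + 2 * P) * 1ℤ))
          - (M * (A * A + + 4 * (P * P)) - + 12 * (e * (A * P)) - + 3 * (e * (A * A + + 4 * (Q * Q)) - + 4 * (M * (A * Q))))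
        ≡ - + 4 * (+ 3 * (e * (P * P)) - M * (A * P) - (+ 3 * (e * (Q * Q)) - + 3 * (M * (A * Q))))
      identity = solve-∀

  opaque
    unfolding M′ e′

    term₁ : (M - e) * (A + + 2 * Q) ^ 2 ≡ M′ - e′
    term₁ = ≡-modulo (- + 4) PQ-relation₁ (identity M e A P Q)
      where
      identity : ∀ M e A P Q →
        (M - e) * ((A + + 2 * Q) * ((A + + 2 * Q) * 1ℤ))
          - (M * (A * A + + 4 * (P * P)) - + 12 * (e * (A * P)) - (e * (A * A + + 4 * (Q * Q)) - + 4 * (M * (A * Q))))
        ≡ - + 4 * (M * (P * P) - + 3 * (e * (A * P)) - (M * (Q * Q) - e * (A * Q)))
      identity = solve-∀

  opaque
    unfolding M′ e′

    term₂ : (M + e) * (A + + 2 * - Q) ^ 2 ≡ M′ + e′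
    term₂ = ≡-modulo (- + 4) PQ-relation₁ (identity M e A P Q)
      where
      identity : ∀ M e A P Q →
        (M + e) * ((A + + 2 * - Q) * ((A + + 2 * - Q) * 1ℤ))
          - (M * (A * A + + 4 * (P * P)) - + 12 * (e * (A * P)) + (e * (A * A + + 4 * (Q * Q)) - + 4 * (M * (A * Q))))
        ≡ - + 4 * (M * (P * P) - + 3 * (e * (A * P)) - (M * (Q * Q) - e * (A * Q)))
      identity = solve-∀

  opaque
    unfolding M′ e′

    term₃ : (M + + 3 * e) * (A + + 2 * - P) ^ 2 ≡ M′ + + 3 * e′
    term₃ = ≡-modulo (+ 4) PQ-relation₂ (identity M e A P Q)
      where
      identity : ∀ M e A P Q →
        (M + + 3 * e) * ((A + + 2 * - P) * ((A + + 2 * - P) * 1ℤ))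
          - (M * (A * A + + 4 * (P * P)) - + 12 * (e * (A * P)) + + 3 * (e * (A * A + + 4 * (Q * Q)) - + 4 * (M * (A * Q))))
        ≡ + 4 * (+ 3 * (e * (P * P)) - M * (A * P) - (+ 3 * (e * (Q * Q)) - + 3 * (M * (A * Q))))
      identity = solve-∀

  opaque
    unfolding A

    -- Modulo 2, `A` is `(M + e)⁴`.
    odd-A : ¬ + 2 ∣ M + e → ¬ + 2 ∣ A
    odd-A odd 2∣A = odd (∣-square prime[2] (M + e) (∣-square prime[2] ((M + e) * (M + e))
      (∣-combination 1ℤ (+ 2 * M * M * M * e + + 3 * M * M * e * e + + 2 * M * e * e * e + + 5 * e * e * e * e)
        2∣A ∣-refl (identity M e))))
      where
      identity : ∀ M e → (M + e) * (M + e) * ((M + e) * (M + e)) ≡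
        1ℤ * (M * M * M * M - + 9 * (e * e * e * e))
        + (+ 2 * M * M * M * e + + 3 * M * M * e * e + + 2 * M * e * e * e + + 5 * e * e * e * e) * + 2
      identity = solve-∀

  odd-A+ : ¬ + 2 ∣ M + e → ∀ r → ¬ + 2 ∣ A + + 2 * r
  odd-A+ odd r 2∣ = odd-A odd (∣-combination 1ℤ (- r) 2∣ ∣-refl (identity A r))
    where
    identity : ∀ A r → A ≡ 1ℤ * (A + + 2 * r) + - r * + 2
    identity = solve-∀

  -- Modulo `P`, `M′` is `M A²`.
  ∣P∣M′⇒∣M⊎∣A : Prime p → + p ∣ P → + p ∣ M′ → + p ∣ M ⊎ + p ∣ A
  ∣P∣M′⇒∣M⊎∣A {p} p-prime p∣P p∣M′ with ∣-split p-prime M (A * A) p∣MA²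
    where
    opaque
      unfolding M′

      p∣MA² : + p ∣ M * (A * A)
      p∣MA² = ∣-combination 1ℤ (+ 12 * (e * A) - + 4 * (M * P)) p∣M′ p∣P (identity M e A P)
        where
        identity : ∀ M e A P → M * (A * A) ≡
          1ℤ * (M * (A * A + + 4 * (P * P)) - + 12 * (e * (A * P))) + (+ 12 * (e * A) - + 4 * (M * P)) * P
        identity = solve-∀
  ... | inj₁ p∣M  = inj₁ p∣M
  ... | inj₂ p∣A² = inj₂ (∣-square p-prime A p∣A²)

  -- Modulo `Q`, `e′` is `e A²`.
  ∣Q∣e′⇒∣e⊎∣A : Prime p → + p ∣ Q → + p ∣ e′ → + p ∣ e ⊎ + p ∣ A
  ∣Q∣e′⇒∣e⊎∣A {p} p-prime p∣Q p∣e′ with ∣-split p-prime e (A * A) p∣eA²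
    where
    opaque
      unfolding e′

      p∣eA² : + p ∣ e * (A * A)
      p∣eA² = ∣-combination 1ℤ (+ 4 * (M * A) - + 4 * (e * Q)) p∣e′ p∣Q (identity M e A Q)
        where
        identity : ∀ M e A Q → e * (A * A) ≡
          1ℤ * (e * (A * A + + 4 * (Q * Q)) - + 4 * (M * (A * Q))) + (+ 4 * (M * A) - + 4 * (e * Q)) * Q
        identity = solve-∀
  ... | inj₁ p∣e  = inj₁ p∣e
  ... | inj₂ p∣A² = inj₂ (∣-square p-prime A p∣A²)

  opaque
    unfolding A

    ∣3e∣A⇒∣M : Prime p → + p ∣ + 3 * e → + p ∣ A → + p ∣ M
    ∣3e∣A⇒∣M p-prime p∣3e p∣A = ∣-square p-prime M (∣-square p-prime (M * M)
      (∣-combination 1ℤ (+ 3 * e * e * e) p∣A p∣3e (identity M e)))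
      where
      identity : ∀ M e → M * M * (M * M) ≡
        1ℤ * (M * M * M * M - + 9 * (e * e * e * e)) + + 3 * e * e * e * (+ 3 * e)
      identity = solve-∀

    ∣M∣A⇒∣3e : Prime p → + p ∣ M → + p ∣ A → + p ∣ + 3 * e
    ∣M∣A⇒∣3e p-prime p∣M p∣A = ∣-square p-prime (+ 3 * e) (∣-square p-prime (+ 3 * e * (+ 3 * e))
      (∣-combination (- + 9) (+ 9 * (M * M * M)) p∣A p∣M (identity M e)))
      where
      identity : ∀ M e → + 3 * e * (+ 3 * e) * (+ 3 * e * (+ 3 * e)) ≡
        - + 9 * (M * M * M * M - + 9 * (e * e * e * e)) + + 9 * (M * M * M) * M
      identity = solve-∀

  opaque
    unfolding P Q

    ∣3e⇒∣P : + p ∣ + 3 * e → + p ∣ P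
    ∣3e⇒∣P {p} p∣3e = subst (+ p ∣_) (identity M e) (∣n⇒∣m*n (M * (M * M - e * e)) p∣3e)
      where
      identity : ∀ M e → M * (M * M - e * e) * (+ 3 * e) ≡ + 3 * (M * (e * (M * M - e * e)))
      identity = solve-∀

    ∣M⇒∣Q : + p ∣ M → + p ∣ Q
    ∣M⇒∣Q p∣M = ∣m⇒∣m*n (e * (M * M - + 9 * (e * e))) p∣M

  ∣3e∣M′⇒∣M : Prime p → + p ∣ + 3 * e → + p ∣ M′ → + p ∣ M
  ∣3e∣M′⇒∣M p-prime p∣3e p∣M′ =
    [ (λ p∣M → p∣M) , ∣3e∣A⇒∣M p-prime p∣3e ]′ (∣P∣M′⇒∣M⊎∣A p-prime (∣3e⇒∣P p∣3e) p∣M′)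

  ∣M∣e′⇒∣3e : Prime p → + p ∣ M → + p ∣ e′ → + p ∣ + 3 * e
  ∣M∣e′⇒∣3e p-prime p∣M p∣e′ =
    [ ∣n⇒∣m*n (+ 3) , ∣M∣A⇒∣3e p-prime p∣M ]′ (∣Q∣e′⇒∣e⊎∣A p-prime (∣M⇒∣Q p∣M) p∣e′)

  -- Tripling preserves coprime 2-full progressions

  module _ (π : Progression M e) where
    open Progression π

    2∤M′+e′ : ¬ + 2 ∣ M′ + e′
    2∤M′+e′ 2∣ = [ odd , odd-g² ]′ (∣-split prime[2] (M + e) _ (subst (+ 2 ∣_) (sym term₂) 2∣))
      where
      g = A + + 2 * - Q
      odd-g² : ¬ + 2 ∣ g ^ 2
      odd-g² 2∣g² = odd-A+ odd (- Q) (∣-square prime[2] g (subst (λ h → + 2 ∣ g * h) (*-identityʳ g) 2∣g²))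

    -- A common prime `p` of `M′` and `e′` divides none of 2, 3, `e`, `M`. It divides all four new
    -- terms but not both multipliers of a pair, so it divides an old outer and an old inner term,
    -- and thus `4e`.
    private module _ {p} (p-prime : Prime p) (p∣M′ : + p ∣ M′) (p∣e′ : + p ∣ e′) where
      p∤2 : ¬ + p ∣ + 2
      p∤2 p∣2 with ∣-prime⇒≡ p-prime prime[2] p∣2
      ... | refl = 2∤M′+e′ (∣m∣n⇒∣m+n p∣M′ p∣e′)

      p∤3 : ¬ + p ∣ + 3
      p∤3 p∣3 with ∣-prime⇒≡ p-prime prime[3] p∣3
      ... | refl = 3∤M (∣3e∣M′⇒∣M prime[3] (∣m⇒∣m*n e ∣-refl) p∣M′)

      p∤e : ¬ + p ∣ e
      p∤e p∣e = coprime p p-prime (∣3e∣M′⇒∣M p-prime (∣n⇒∣m*n (+ 3) p∣e) p∣M′) p∣e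

      p∤M : ¬ + p ∣ M
      p∤M p∣M = [ p∤3 , p∤e ]′ (∣-split p-prime (+ 3) e (∣M∣e′⇒∣3e p-prime p∣M p∣e′))

      strip : ∀ a b → ¬ + p ∣ a → + p ∣ a * b → + p ∣ b
      strip a b p∤a p∣ab = [ ⊥-elim ∘ p∤a , (λ p∣b → p∣b) ]′ (∣-split p-prime a b p∣ab)

      p∤4e : ¬ + p ∣ + 2 * (+ 2 * e)
      p∤4e = p∤e ∘ strip (+ 2) e p∤2 ∘ strip (+ 2) (+ 2 * e) p∤2

      factor : ∀ c g → + p ∣ c * g ^ 2 → + p ∣ c ⊎ + p ∣ g
      factor c g p∣cg² with ∣-split p-prime c (g ^ 2) p∣cg²
      ... | inj₁ p∣c  = inj₁ p∣c
      ... | inj₂ p∣g² = inj₂ (∣-square p-prime g (subst (λ h → + p ∣ g * h) (*-identityʳ g) p∣g²))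

      ∣A±r⇒∣r : ∀ r → + p ∣ A + + 2 * r → + p ∣ A + + 2 * - r → + p ∣ r
      ∣A±r⇒∣r r p∣+ p∣- = strip (+ 2) r p∤2 (strip (+ 2) (+ 2 * r) p∤2 (∣-combination 1ℤ (- 1ℤ) p∣+ p∣- (identity A r)))
        where
        identity : ∀ A r → + 2 * (+ 2 * r) ≡ 1ℤ * (A + + 2 * r) + - 1ℤ * (A + + 2 * - r)
        identity = solve-∀

      ∣A±r⇒∣A : ∀ r → + p ∣ A + + 2 * r → + p ∣ r → + p ∣ A
      ∣A±r⇒∣A r p∣+ p∣r = ∣-combination 1ℤ (- + 2) p∣+ p∣r (identity A r)
        where
        identity : ∀ A r → A ≡ 1ℤ * (A + + 2 * r) + - + 2 * r
        identity = solve-∀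

      opaque
        unfolding A P Q

        -- `p` must divide `M² − e²`, modulo which `A` is `−8e⁴`.
        P-A-coprime : + p ∣ P → + p ∣ A → ⊥
        P-A-coprime p∣P p∣A = p∤4e (∣-square p-prime _ (∣-square p-prime _
          (∣-combination (+ 32 * (M * M + e * e)) (- + 32) p∣m p∣A (identity M e))))
          where
          identity : ∀ M e → let c = + 2 * (+ 2 * e) in c * c * (c * c) ≡
            + 32 * (M * M + e * e) * (M * M - e * e) + - + 32 * (M * M * M * M - + 9 * (e * e * e * e))
          identity = solve-∀
          p∣m : + p ∣ M * M - e * e
          p∣m = strip e _ p∤e (strip M _ p∤M (strip (+ 3) _ p∤3 p∣P))

        -- `p` must divide `M² − 9e²`, modulo which `A` is `72e⁴`.
        Q-A-coprime : + p ∣ Q → + p ∣ A → ⊥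
        Q-A-coprime p∣Q p∣A = p∤6e (∣-square p-prime _ (∣-square p-prime _
          (∣-combination (- + 18 * (M * M + + 9 * (e * e))) (+ 18) p∣n p∣A (identity M e))))
          where
          identity : ∀ M e → let c = + 2 * (+ 3 * e) in c * c * (c * c) ≡
            - + 18 * (M * M + + 9 * (e * e)) * (M * M - + 9 * (e * e)) + + 18 * (M * M * M * M - + 9 * (e * e * e * e))
          identity = solve-∀
          p∣n : + p ∣ M * M - + 9 * (e * e)
          p∣n = strip e _ p∤e (strip M _ p∤M p∣Q)
          p∤6e : ¬ + p ∣ + 2 * (+ 3 * e)
          p∤6e = p∤e ∘ strip (+ 3) e p∤3 ∘ strip (+ 2) _ p∤2

      A±2P : + p ∣ A + + 2 * P → + p ∣ A + + 2 * - P → ⊥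
      A±2P p∣+ p∣- = P-A-coprime p∣P (∣A±r⇒∣A P p∣+ p∣P)
        where
        p∣P : + p ∣ P
        p∣P = ∣A±r⇒∣r P p∣+ p∣-

      A±2Q : + p ∣ A + + 2 * Q → + p ∣ A + + 2 * - Q → ⊥
      A±2Q p∣+ p∣- = Q-A-coprime p∣Q (∣A±r⇒∣A Q p∣+ p∣Q)
        where
        p∣Q : + p ∣ Q
        p∣Q = ∣A±r⇒∣r Q p∣+ p∣-

      outer-term : + p ∣ M - + 3 * e ⊎ + p ∣ M + + 3 * e
      outer-term with factor _ _ (subst (+ p ∣_) (sym term₀) (∣m∣n⇒∣m-n p∣M′ (∣n⇒∣m*n (+ 3) p∣e′)))
                    | factor _ _ (subst (+ p ∣_) (sym term₃) (∣m∣n⇒∣m+n p∣M′ (∣n⇒∣m*n (+ 3) p∣e′)))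
      ... | inj₁ p∣T | _        = inj₁ p∣T
      ... | _        | inj₁ p∣T = inj₂ p∣T
      ... | inj₂ p∣+ | inj₂ p∣- = ⊥-elim (A±2P p∣+ p∣-)

      inner-term : + p ∣ M - e ⊎ + p ∣ M + e
      inner-term with factor _ _ (subst (+ p ∣_) (sym term₁) (∣m∣n⇒∣m-n p∣M′ p∣e′))
                    | factor _ _ (subst (+ p ∣_) (sym term₂) (∣m∣n⇒∣m+n p∣M′ p∣e′))
      ... | inj₁ p∣T | _        = inj₁ p∣T
      ... | _        | inj₁ p∣T = inj₂ p∣T
      ... | inj₂ p∣+ | inj₂ p∣- = ⊥-elim (A±2Q p∣+ p∣-)

      no-common-prime : ⊥
      no-common-prime with outer-term | inner-term
      ... | inj₁ p∣T₀ | inj₁ p∣T₁ = p∤4e (∣-combination (- + 2) (+ 2) p∣T₀ p∣T₁ (identity M e))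
        where
        identity : ∀ M e → + 2 * (+ 2 * e) ≡ - + 2 * (M - + 3 * e) + + 2 * (M - e)
        identity = solve-∀
      ... | inj₁ p∣T₀ | inj₂ p∣T₂ = p∤4e (∣-combination (- 1ℤ) 1ℤ p∣T₀ p∣T₂ (identity M e))
        where
        identity : ∀ M e → + 2 * (+ 2 * e) ≡ - 1ℤ * (M - + 3 * e) + 1ℤ * (M + e)
        identity = solve-∀
      ... | inj₂ p∣T₃ | inj₁ p∣T₁ = p∤4e (∣-combination 1ℤ (- 1ℤ) p∣T₃ p∣T₁ (identity M e))
        where
        identity : ∀ M e → + 2 * (+ 2 * e) ≡ 1ℤ * (M + + 3 * e) + - 1ℤ * (M - e)
        identity = solve-∀
      ... | inj₂ p∣T₃ | inj₂ p∣T₂ = p∤4e (∣-combination (+ 2) (- + 2) p∣T₃ p∣T₂ (identity M e))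
        where
        identity : ∀ M e → + 2 * (+ 2 * e) ≡ + 2 * (M + + 3 * e) + - + 2 * (M + e)
        identity = solve-∀

    tripled : Progression M′ e′
    tripled = progression
      (λ p p-prime p∣M′ p∣e′ → no-common-prime p-prime p∣M′ p∣e′)
      2∤M′+e′
      (3∤M ∘ ∣3e∣M′⇒∣M prime[3] (∣m⇒∣m*n e ∣-refl))
      (subst (Fullℤ 2) term₀ (fullℤ-*-square _ (≢0 P) full₀))
      (subst (Fullℤ 2) term₁ (fullℤ-*-square _ (≢0 Q) full₁))
      (subst (Fullℤ 2) term₂ (fullℤ-*-square _ (≢0 (- Q)) full₂))
      (subst (Fullℤ 2) term₃ (fullℤ-*-square _ (≢0 (- P)) full₃))
      where
      -- The multipliers are odd, hence nonzero.
      ≢0 : ∀ r → A + + 2 * r ≢ 0ℤ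
      ≢0 r eq = odd-A+ odd r (subst (+ 2 ∣_) (sym eq) (divides 0ℤ refl))

    -- Growth of the midpoint

    0<M : 0ℤ < e → 0ℤ < M
    0<M 0<e = subst (0ℤ <_) (identity M e) (0<+ (proj₁ full₀) (0<* (0<suc 2) 0<e))
      where
      identity : ∀ M e → M - + 3 * e + + 3 * e ≡ M
      identity = solve-∀

    opaque
      unfolding A P

      -- `A = (M² − 3e²)(M² + 3e²)` is positive, and `2P = 6Mq` with `q = e(M − e)(M + e) ≥ 1`.
      2M<A+2P : 0ℤ < e → + 2 * M < A + + 2 * P
      2M<A+2P 0<e = -≡⇒< (identity M e)
        (0<+ (0<* (0<+ (0<* (proj₁ full₀) (proj₁ full₃)) (0<* (0<suc 5) 0<e²)) (0<+ (0<* 0<m 0<m) (0<* (0<suc 2) 0<e²)))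
             (0<* (0<* (0<suc 1) 0<m) (0<+0≤ (0<* (0<suc 1) 0<q) (0<⇒0≤-1 0<q))))
        where
        0<m : 0ℤ < M
        0<m = 0<M 0<e
        0<e² : 0ℤ < e * e
        0<e² = 0<* 0<e 0<e
        0<q : 0ℤ < e * ((M - e) * (M + e))
        0<q = 0<* 0<e (0<* (proj₁ full₁) (proj₁ full₂))
        identity : ∀ M e → let q = e * ((M - e) * (M + e)) in
          M * M * M * M - + 9 * (e * e * e * e) + + 2 * (+ 3 * (M * (e * (M * M - e * e)))) - + 2 * M ≡
          ((M - + 3 * e) * (M + + 3 * e) + + 6 * (e * e)) * (M * M + + 3 * (e * e)) + + 2 * M * (+ 2 * q + (q - 1ℤ))
        identity = solve-∀

    -- `2M′` is the sum of the new outer terms; one is positive and the other, `(M − 3e)(A + 2P)²`,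
    -- is at least `A + 2P > 2M`.
    M<M′ : 0ℤ < e → M < M′
    M<M′ 0<e = -≡⇒< refl (*-cancelˡ-<-nonNeg (+ 2)
      (subst (0ℤ <_) (sym (≡-modulo 1ℤ (sym term₀) (identity M e M′ e′ S)))
        (0<+ (0<+0≤ (0<+0≤ (proj₁ (Progression.full₃ tripled))
          (0≤* (0<⇒0≤-1 (proj₁ full₀)) (<⇒≤ (0<* 0<S 0<S)))) (0≤* (<⇒≤ 0<S) (0<⇒0≤-1 0<S)))
          (<⇒0<- (2M<A+2P 0<e)))))
      where
      S : ℤ
      S = A + + 2 * P
      0<S : 0ℤ < S
      0<S = <-trans (0<* (0<suc 1) (0<M 0<e)) (2M<A+2P 0<e)
      identity : ∀ M e M′ e′ S →
        + 2 * (M′ - M) - (M′ + + 3 * e′ + (M - + 3 * e - 1ℤ) * (S * S) + S * (S - 1ℤ) + (S - + 2 * M))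
        ≡ 1ℤ * (M′ - + 3 * e′ - (M - + 3 * e) * (S * (S * 1ℤ)))
      identity = solve-∀

-- The starting progression and the 2-full conclusions

M₀ e₀ : ℤ
M₀ = + 251395608448225429493113843173549372048588232576296226596677457190200589068321640982036988219529939223029504504
e₀ = + 35122673869153479016615085685528193217413977276932409870972078635782176155643570483291500569152539716515691621

-- Seven times a point on w² = (X + 2)(X + 3)(X + 6) twisted by 105 = 1·3·5·7, whence the factors aᵢ³.
start : Progression M₀ e₀
start = progression
  (λ p p-prime p∣M p∣e → ¬prime[1] (subst Prime (ℕ.∣1⇒≡1 (∣⇒∣ᵤ (∣-combination {b = e₀}
    (+ 185715340886594766925969580959812697985740626087060081249082018237231279249709407901657357868644713237131829)
    (- + 1329284361842362089458748365396213967067517185668022778286838587197146542468573409630922197515206477925013515)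
    p∣M p∣e refl))) p-prime))
  (from-no (+ 2 ∣? M₀ + e₀))
  (from-no (+ 3 ∣? M₀))
  (full 1 12084187471268599631451234060176599755724964604448526371)
  (full 3 2830213541080209011791947074416752429676809104441705427)
  (full 5 1513983572744113782076139367183623671834014681687852337)
  (full 7 1019866266394045520377101721340559471503324701580032313)
  where
  -- `a³b²` is written as `a(ab)²`, so that a prime of the coefficient `a` divides the squared
  -- factor.
  full : ∀ a b .{{_ : ℕ.NonZero a}} .{{_ : ℕ.NonZero b}} → Fullℤ 2 (+ a * (+ a * + b) ^ 2)
  full a@(suc _) b@(suc _) = fullℤ-*^ 2 (+ a) (+ a * + b) (+<+ (s≤s z≤n))
    λ p p-prime p∣a → inj₂ (∣⇒∣ᵤ (∣m⇒∣m*n (+ b) (∣ᵤ⇒∣ {+ p} {+ a} p∣a)))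

unbounded-progressions : ∀ n → ∃₂ λ M e → Progression M e × 0ℤ < e × + n < M
unbounded-progressions zero = _ , _ , start , +<+ (s≤s z≤n) , +<+ (s≤s z≤n)
unbounded-progressions (suc n) with unbounded-progressions n
... | M , e , π , 0<e , n<M = choose (<-cmp 0ℤ e′)
  where
  open Tripling M e
  sn<M′ : + suc n < M′
  sn<M′ = ≤-<-trans (i<j⇒suc[i]≤j n<M) (M<M′ π 0<e)
  choose : Tri (0ℤ < e′) (0ℤ ≡ e′) (e′ < 0ℤ) → ∃₂ λ M e → Progression M e × 0ℤ < e × + suc n < M
  choose (tri< 0<e′ _ _) = M′ , e′ , tripled π , 0<e′ , sn<M′
  choose (tri> _ _ e′<0) = M′ , - e′ , flip (tripled π) , neg-mono-< e′<0 , sn<M′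
  -- If `e′` were 0, coprimality would force `M′` to be a unit, but it exceeds `suc n`.
  choose (tri≈ _ 0≡e′ _) = ⊥-elim (>1⇒∣∣≢1 sn<M′ (coprimeℤ-0⇒≡1 (subst (Coprimeℤ M′) (sym 0≡e′) (Progression.coprime (tripled π)))))
    where
    >1⇒∣∣≢1 : ∀ {a} → + suc n < a → abs a ≢ 1
    >1⇒∣∣≢1 (+<+ (s≤s ())) refl

infinitely-many-4-2 : InfinitelyManyGood 4 2
infinitely-many-4-2 B with unbounded-progressions (B ℕ.+ B)
... | M , e , progression co odd 3∤M f₀ f₁ f₂ f₃ , 0<e , 2B<M =
  goodℤ 4 2 B (M - + 3 * e) (+ 2 * e) large (proj₁ f₀) (0<* (0<suc 1) 0<e) full no-common
  where
  large : + B < M - + 3 * e + + 2 * e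
  -- The second term is `M − e`, and `2(M − e) = M + (M − 3e) + e` exceeds `M > 2B`.
  large = -≡⇒< refl (*-cancelˡ-<-nonNeg (+ 2) (subst (0ℤ <_) (identity M e (+ B))
    (0<+ (0<+ (<⇒0<- 2B<M) (proj₁ f₀)) 0<e)))
    where
    identity : ∀ M e b → M - (b + b) + (M - + 3 * e) + e ≡ + 2 * (M - + 3 * e + + 2 * e - b)
    identity = solve-∀

  no-common : Coprimeℤ (+ 2 * e) (M - + 3 * e)
  no-common p p-prime p∣2e p∣T with ∣-split p-prime (+ 2) e p∣2e
  ... | inj₂ p∣e = co p p-prime (∣-combination 1ℤ (+ 3) p∣T p∣e (identity M e)) p∣e
    where
    identity : ∀ M e → M ≡ 1ℤ * (M - + 3 * e) + + 3 * e
    identity = solve-∀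
  ... | inj₁ p∣2 with ∣-prime⇒≡ p-prime prime[2] p∣2
  -- For `p = 2`, an even first term would make `M + e` even.
  ...   | refl = odd (∣-combination 1ℤ (+ 2) p∣T p∣2e (identity M e))
    where
    identity : ∀ M e → M + e ≡ 1ℤ * (M - + 3 * e) + + 2 * (+ 2 * e)
    identity = solve-∀

  full : ∀ i → i ℕ.< 4 → Fullℤ 2 (M - + 3 * e + + i * (+ 2 * e))
  full 0 _ = subst (Fullℤ 2) (identity M e) f₀
    where
    identity : ∀ M e → M - + 3 * e ≡ M - + 3 * e + + 0 * (+ 2 * e)
    identity = solve-∀
  full 1 _ = subst (Fullℤ 2) (identity M e) f₁
    where
    identity : ∀ M e → M - e ≡ M - + 3 * e + + 1 * (+ 2 * e)
    identity = solve-∀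
  full 2 _ = subst (Fullℤ 2) (identity M e) f₂
    where
    identity : ∀ M e → M + e ≡ M - + 3 * e + + 2 * (+ 2 * e)
    identity = solve-∀
  full 3 _ = subst (Fullℤ 2) (identity M e) f₃
    where
    identity : ∀ M e → M + + 3 * e ≡ M - + 3 * e + + 3 * (+ 2 * e)
    identity = solve-∀
  full (suc (suc (suc (suc _)))) (s≤s (s≤s (s≤s (s≤s ()))))

infinitely-many-3-2 : InfinitelyManyGood 3 2
infinitely-many-3-2 B with infinitely-many-4-2 B
... | N , d , B<N+d , 0<N , 0<d , full , gcd≡1 = N , d , B<N+d , 0<N , 0<d , (λ i i<3 → full i (ℕ.m<n⇒m<1+n i<3)) , gcd≡1

theorem2 : InfinitelyManyGood 3 2 × InfinitelyManyGood 3 3 × InfinitelyManyGood 4 2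
theorem2 = infinitely-many-3-2 , infinitely-many-3-3 , infinitely-many-4-2
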